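{- Every locally tractable probability distribution is tractable.
   Context: Notation: $\mathbb{N}_0$ is the set of nonnegative integers; $\mathbb{N}_0^{>M}=\{n\in\mathbb{N}_0: n>M\}$. A probability distribution on a countable set is a function $T$ from that set to $[0,1]$ whose values sum to $1$. Its domain is $\mathrm{dom}\,T=\{x: T(x)>0\}$. Write $X=\mathrm{dom}\,T$, and $T(L)=\sum_{x\in L}T(x)$ for subsets $L$. For $Y\subseteq X$ (nonempty), the conditional distribution $(T|Y)$ has domain $Y$ and $(T|Y)(y)=T(y)/T(Y)$. Truncated distribution: for a finite subset $F=\{x_1,\dots,x_k\}$ of $X$, $T^F$ is the distribution with domain contained in $F\cup\{\bot\}$, where $\bot$ is an object outside $X$, given by $T^F(x_i)=T(x_i)$ and $T^F(\bot)=1-T(F)$. Computational model: randomized algorithms with unit cost for arithmetic operations on real numbers and unit cost for $\mathsf{tossCoin}(p)$, which returns $0$ with probability $p$ and $1$ with probability $1-p$, for $p\in[0,1]$. It is assumed available that from an explicitly listed finite distribution $(D(x_1),\dots,D(x_k))$ one can select $x_i$ with probability $D(x_i)$ in time $O(k)$. Tractable: a distribution $T$ with domain $X$ is tractable if there is a randomized algorithm $\mathsf{select}_T(\delta)$, for $\delta\in(0,1)$, that runs in time polynomial in $1/\delta$ and randomly selects an element from the truncated distribution $T^F$, where $F$ is a finite set of elements of $X$ determined once by the algorithm (it is kept in a static variable over repeated invocations) such that $T(X\setminus F)\le\delta$. Locally tractable: a distribution $T$ whose domain $X$ has a size function $\mathsf{sz}:X\to\mathbb{N}_0$ (i.e.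 for each $m\in\mathbb{N}_0$ the set $\mathsf{sz}^{ -1}(m)=\{x\in X:\mathsf{sz}(x)=m\}$ is finite) is locally tractable if: 1. there is a randomized algorithm $\mathsf{sizeSelect}_T(m)$, $m\in\mathbb{N}_0$ (with $\mathsf{sz}^{ -1}(m)\neq\emptyset$), that selects an element from $\big(T|\mathsf{sz}^{ -1}(m)\big)$ and works in time polynomial in $m$; 2. there is an algorithm $\mathsf{prob}_T(m)$, $m\in\mathbb{N}_0$, that returns the value $T\big(\mathsf{sz}^{ -1}(m)\big)$ and works in time polynomial in $m$; 3. for all $\delta\in(0,1)$ there is $M\in\mathbb{N}_0$ such that $T\big(\mathsf{sz}^{ -1}(\mathbb{N}_0^{>M})\big)\le\delta$, where $M=O\big((1/\delta)^k\big)$ for some $k\in\mathbb{N}_0$, and there is an algorithm $\mathsf{maxLen}_T(\delta)$ that returns such an $M$ and works in time polynomial in $1/\delta$. -}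

module Defs where

open import Algebra.Bundles using (CommutativeRing)
open import Algebra.Structures using (IsCommutativeRing)
import Algebra.Properties.Semiring.Exp as Exp
import Algebra.Properties.Semiring.Mult as Mult
open import Data.List.Base using (List; []; _∷_; _++_; foldr; map; length; filter; cartesianProductWith)
open import Data.List.Properties using (map-∘)
import Data.List.Membership.DecPropositional as DecMembership
open import Data.List.Membership.Propositional using (_∈_; _∉_)
open import Data.List.Relation.Unary.All using (All; []; universal)
open import Data.List.Relation.Unary.Unique.Propositional using (Unique; [])
import Data.List.Relation.Unary.Unique.Propositional.Properties as Unique
open import Data.Maybe.Base using (Maybe; just; nothing)
open import Data.Nat.Base as ℕ using (ℕ)
import Data.Nat.Properties as ℕ
open import Data.Product.Base using (∃; ∃-syntax; _×_; _,_; proj₁; proj₂)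
open import Data.Refinement using (Refinement; Refinement-syntax; value; _,_)
import Data.Refinement.Properties as Refinement
open import Data.Unit.Base using (⊤; tt)
open import Function.Base using (_∘_)
open import Function.Bundles using (_↣_; module Injection)
import Relation.Binary.Construct.NonStrictToStrict as ToStrict
open import Relation.Binary.Definitions using (DecidableEquality)
open import Relation.Binary.PropositionalEquality
  using (_≡_; _≢_; refl; sym; cong; cong₂; subst)
open import Relation.Binary.Structures using (IsDecTotalOrder)
open import Relation.Nullary using (Dec; yes; no; ¬?)
open import Relation.Nullary.Decidable using (map′; _×-dec_; via-injection)
open import Relation.Unary using (Decidable)

-- The classical real numbers: a complete ordered field, unique up to
-- isomorphism.  The order is decidable because the machine below branches on
-- comparisons at unit cost; 0# ⁻¹ is unspecified.

record Reals : Set₁ where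
  infix  8 _⁻¹
  infixl 7 _*_ _/_
  infixl 6 _+_ _-_
  infix  4 _≤_
  field
    ℝ     : Set
    _+_   : ℝ → ℝ → ℝ
    _*_   : ℝ → ℝ → ℝ
    -_    : ℝ → ℝ
    0#    : ℝ
    1#    : ℝ
    _⁻¹   : ℝ → ℝ
    _≤_   : ℝ → ℝ → Set
    isCommutativeRing : IsCommutativeRing _≡_ _+_ _*_ -_ 0# 1#
    0≢1               : 0# ≢ 1#
    *-inverseʳ        : ∀ x → x ≢ 0# → x * x ⁻¹ ≡ 1#
    isDecTotalOrder   : IsDecTotalOrder _≡_ _≤_
    +-monoˡ-≤         : ∀ z {x y} → x ≤ y → x + z ≤ y + z
    *-nonneg          : ∀ {x y} → 0# ≤ x → 0# ≤ y → 0# ≤ x * y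

  IsUpperBound : (ℝ → Set) → ℝ → Set
  IsUpperBound P b = ∀ x → P x → x ≤ b

  IsSupremum : (ℝ → Set) → ℝ → Set
  IsSupremum P s = IsUpperBound P s × (∀ b → IsUpperBound P b → s ≤ b)

  field
    complete : ∀ (P : ℝ → Set) → ∃ P → ∃ (IsUpperBound P) → ∃ (IsSupremum P)

  commutativeRing : CommutativeRing _ _
  commutativeRing = record { isCommutativeRing = isCommutativeRing }

  open CommutativeRing commutativeRing public using (semiring)
  open IsDecTotalOrder isDecTotalOrder public using (_≟_; _≤?_)
  open ToStrict _≡_ _≤_ public using (_<_)
  open Exp semiring public using (_^_)

  _-_ : ℝ → ℝ → ℝ
  x - y = x + (- y)

  _/_ : ℝ → ℝ → ℝ
  x / y = x * y ⁻¹

  fromℕ : ℕ → ℝ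
  fromℕ n = n ·ℝ 1#
    where open Mult semiring renaming (_×_ to _·ℝ_)

  sum : List ℝ → ℝ
  sum = foldr _+_ 0#

module _ (R : Reals) where
  open Reals R

  data PartialSum {A : Set} (f : A → ℝ) (L : A → Set) : ℝ → Set where
    partial : ∀ xs → Unique xs → All L xs → PartialSum f L (sum (map f xs))

  -- For f ≥ 0, Σ_{x ∈ L} f x = s: the supremum of the finite partial sums.
  HasSum : {A : Set} → (A → ℝ) → (A → Set) → ℝ → Set
  HasSum f L s = IsSupremum (PartialSum f L) s

  record Distribution (A : Set) : Set where
    field
      countable : A ↣ ℕ
      pr        : A → ℝ
      pr≥0      : ∀ x → 0# ≤ pr x
      pr≤1      : ∀ x → pr x ≤ 1#
      total     : HasSum pr (λ _ → ⊤) 1#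

  module _ {A : Set} (T : Distribution A) where
    open Distribution T

    Dom : Set
    Dom = [ x ∈ A ∣ 0# < pr x ]

    prob : Dom → ℝ
    prob = pr ∘ value

    _≟D_ : DecidableEquality Dom
    _≟D_ = Refinement._≟_ (via-injection countable ℕ._≟_)

    massSum : (L : Dom → Set) → ∃ (HasSum prob L)
    massSum L = complete (PartialSum prob L) (_ , partial [] [] []) (1# , bounded)
      where
      bounded : IsUpperBound (PartialSum prob L) 1#
      bounded _ (partial xs u _) =
        subst (_≤ 1#) (cong sum (sym (map-∘ {g = pr} {f = value} xs)))
          (proj₁ total _ (partial (map value xs)
            (Unique.map⁺ Refinement.value-injective u)
            (universal (λ _ → tt) _)))

    -- T(L)
    mass : (Dom → Set) → ℝ
    mass L = proj₁ (massSum L)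

    -- (T | L), extended by 0 outside L
    conditional : {L : Dom → Set} → Decidable L → Dom → ℝ
    conditional {L} L? x with L? x
    ... | yes _ = prob x / mass L
    ... | no  _ = 0#

    -- T^F, with nothing in the role of ⊥
    truncate : List Dom → Maybe Dom → ℝ
    truncate F nothing = 1# - mass (_∈ F)
    truncate F (just x) with DecMembership._∈?_ _≟D_ x F
    ... | yes _ = prob x
    ... | no  _ = 0#

  -- Randomized algorithms over the reals: a first-order language on binary
  -- trees with real leaves, in which every basic operation has unit cost.
  -- In conditions nil is false and everything else is true.

  data Val : Set where
    nil  : Val
    num  : ℝ → Val
    cons : Val → Val → Val

  _≟V_ : DecidableEquality Val
  nil      ≟V nil      = yes refl
  nil      ≟V num _    = no λ ()
  nil      ≟V cons _ _ = no λ ()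
  num _    ≟V nil      = no λ ()
  num x    ≟V num y    = map′ (cong num) (λ { refl → refl }) (x ≟ y)
  num _    ≟V cons _ _ = no λ ()
  cons _ _ ≟V nil      = no λ ()
  cons _ _ ≟V num _    = no λ ()
  cons a b ≟V cons c d =
    map′ (λ (p , q) → cong₂ cons p q) (λ { refl → refl , refl })
         (a ≟V c ×-dec b ≟V d)

  infixr 5 _⨟_

  data Prog : Set where
    idP    : Prog
    nilP   : Prog
    real   : ℝ → Prog
    fstP   : Prog
    sndP   : Prog
    pairP  : Prog → Prog → Prog
    _⨟_    : Prog → Prog → Prog
    isCons : Prog
    isNum  : Prog
    addP subP mulP divP leqP : Prog
    cond   : Prog → Prog → Prog
    while  : Prog → Prog
    toss   : Prog
    choose : Prog

  -- A result together with the probability of its computation path and the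
  -- number of steps on it.
  record Outcome : Set where
    constructor outcome
    field
      weight : ℝ
      cost   : ℕ
      result : Val
  open Outcome public

  Outcomes : Set
  Outcomes = List Outcome

  pure : ℕ → Val → Outcomes
  pure c v = outcome 1# c v ∷ []

  after : Outcome → Outcome → Outcome
  after (outcome w c _) (outcome w′ c′ v) = outcome (w * w′) (c ℕ.+ c′) v

  tick : Outcome → Outcome
  tick (outcome w c v) = outcome w (ℕ.suc c) v

  pairOutcome : Outcome → Outcome → Outcome
  pairOutcome (outcome w c v) (outcome w′ c′ v′) =
    outcome (w * w′) (ℕ.suc (c ℕ.+ c′)) (cons v v′)

  -- Branches of probability 0 are never taken.
  possible : Outcomes → Outcomes
  possible = filter (λ o → ¬? (weight o ≟ 0#))

  bool : {P : Set} → Dec P → Val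
  bool (yes _) = num 1#
  bool (no  _) = nil

  IsConsVal IsNumVal : Val → Set
  IsConsVal v = ∃[ a ] ∃[ b ] v ≡ cons a b
  IsNumVal  v = ∃[ x ] v ≡ num x

  isCons? : Decidable IsConsVal
  isCons? nil        = no λ ()
  isCons? (num _)    = no λ ()
  isCons? (cons a b) = yes (a , b , refl)

  isNum? : Decidable IsNumVal
  isNum? nil        = no λ ()
  isNum? (num x)    = yes (x , refl)
  isNum? (cons _ _) = no λ ()

  -- An explicitly listed finite distribution, as machine data.
  listing : List (ℝ × Val) → Val
  listing = foldr (λ (d , v) → cons (cons (num d) v)) nil

  infix 4 _⊢_⇓_ _⊢*_⇓_

  -- p ⊢ v ⇓ μ: on input v all computation paths of p terminate, and μ lists
  -- their outcomes.  There is no μ if some path diverges or gets stuck (for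
  -- example on a division by 0).
  -- p ⊢* μ ⇓ ν: the same for p started on the results of μ, with
  -- probabilities multiplied and costs added.
  mutual
    data _⊢_⇓_ : Prog → Val → Outcomes → Set where
      ⇓id   : ∀ {v} → idP ⊢ v ⇓ pure 1 v
      ⇓nil  : ∀ {v} → nilP ⊢ v ⇓ pure 1 nil
      ⇓real : ∀ {r v} → real r ⊢ v ⇓ pure 1 (num r)
      ⇓fst  : ∀ {a b} → fstP ⊢ cons a b ⇓ pure 1 a
      ⇓snd  : ∀ {a b} → sndP ⊢ cons a b ⇓ pure 1 b
      ⇓pair : ∀ {p q v μ ν} → p ⊢ v ⇓ μ → q ⊢ v ⇓ ν →
              pairP p q ⊢ v ⇓ cartesianProductWith pairOutcome μ ν
      ⇓seq  : ∀ {p q v μ ν} → p ⊢ v ⇓ μ → q ⊢* μ ⇓ ν → p ⨟ q ⊢ v ⇓ ν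

      ⇓isCons : ∀ {v} → isCons ⊢ v ⇓ pure 1 (bool (isCons? v))
      ⇓isNum  : ∀ {v} → isNum ⊢ v ⇓ pure 1 (bool (isNum? v))

      ⇓add : ∀ {x y} → addP ⊢ cons (num x) (num y) ⇓ pure 1 (num (x + y))
      ⇓sub : ∀ {x y} → subP ⊢ cons (num x) (num y) ⇓ pure 1 (num (x - y))
      ⇓mul : ∀ {x y} → mulP ⊢ cons (num x) (num y) ⇓ pure 1 (num (x * y))
      ⇓div : ∀ {x y} → y ≢ 0# →
             divP ⊢ cons (num x) (num y) ⇓ pure 1 (num (x / y))
      ⇓leq : ∀ {x y} → leqP ⊢ cons (num x) (num y) ⇓ pure 1 (bool (x ≤? y))

      ⇓true  : ∀ {p q b v μ} → b ≢ nil → p ⊢ v ⇓ μ →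
               cond p q ⊢ cons b v ⇓ map tick μ
      ⇓false : ∀ {p q v μ} → q ⊢ v ⇓ μ →
               cond p q ⊢ cons nil v ⇓ map tick μ

      -- The state of a loop is a continuation flag paired with data.
      ⇓stop : ∀ {p v} → while p ⊢ cons nil v ⇓ pure 1 v
      ⇓step : ∀ {p b v μ ν} → b ≢ nil → p ⊢ v ⇓ μ → while p ⊢* μ ⇓ ν →
              while p ⊢ cons b v ⇓ map tick ν

      ⇓toss : ∀ {p} → 0# ≤ p → p ≤ 1# →
              toss ⊢ num p ⇓
                possible (outcome p 1 (num 0#) ∷ outcome (1# - p) 1 (num 1#) ∷ [])

      ⇓choose : ∀ ds → All (λ d → 0# ≤ proj₁ d) ds → sum (map proj₁ ds) ≡ 1# →
                choose ⊢ listing ds ⇓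
                  possible (map (λ (d , v) → outcome d (length ds) v) ds)

    data _⊢*_⇓_ : Prog → Outcomes → Outcomes → Set where
      []  : ∀ {p} → p ⊢* [] ⇓ []
      _∷_ : ∀ {p o os μ ν} → p ⊢ result o ⇓ μ → p ⊢* os ⇓ ν →
            p ⊢* o ∷ os ⇓ map (after o) μ ++ ν

  Pr : {P : Val → Set} → Decidable P → Outcomes → ℝ
  Pr P? μ = sum (map weight (filter (P? ∘ result) μ))

  TimeAtMost : ℝ → Outcomes → Set
  TimeAtMost b = All (λ o → fromℕ (cost o) ≤ b)

  -- Up to the choice of c and k, every polynomial bound in x ≥ 0 has this form.
  poly : ℝ → ℕ → ℝ → ℝ
  poly c k x = c * x ^ k + c

  -- A run without random choices.
  ReturnsWithin : Prog → Val → Val → ℝ → Set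
  ReturnsWithin p v r b =
    ∃[ t ] p ⊢ v ⇓ pure t r × fromℕ t ≤ b

  -- Elements of the domain are represented in the machine by an arbitrary
  -- injective coding.

  module _ {A : Set} (T : Distribution A) (code : Dom T ↣ Val) where
    open Injection code using (to)

    -- The outputs of select, including ⊥.
    code⊥ : Maybe (Dom T) → Val
    code⊥ (just x) = cons (to x) nil
    code⊥ nothing  = nil

    -- An invocation of select returns its output together with the new
    -- contents of the static variable.
    Output : Maybe (Dom T) → Val → Set
    Output y v = ∃[ s ] v ≡ cons (code⊥ y) s

    output? : ∀ y → Decidable (Output y)
    output? y nil        = no λ ()
    output? y (num _)    = no λ ()
    output? y (cons a s) =
      map′ (λ { refl → s , refl }) (λ { (_ , refl) → refl }) (a ≟V code⊥ y)

    -- The possible contents of the static variable over repeated invocations.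
    data Reachable (select : Prog) (δ : ℝ) : Val → Set where
      initial : Reachable select δ nil
      invoke  : ∀ {s s′ v μ o} → Reachable select δ s →
                select ⊢ cons (num δ) s ⇓ μ → o ∈ μ → result o ≡ cons v s′ →
                Reachable select δ s′

    Tractable : Set
    Tractable =
      ∃[ select ] ∃[ c ] ∃[ k ] ∀ δ → 0# < δ → δ < 1# →
        ∃[ F ] mass T (_∉ F) ≤ δ ×
          (∀ s → Reachable select δ s →
            ∃[ μ ] select ⊢ cons (num δ) s ⇓ μ
                 × (∀ y → Pr (output? y) μ ≡ truncate T F y)
                 × TimeAtMost (poly c k (δ ⁻¹)) μ)

    module _ (sz : Dom T → ℕ) where

      IsSizeFunction : Set
      IsSizeFunction = ∀ m → ∃[ xs ] (∀ x → sz x ≡ m → x ∈ xs)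

      SizeSelectable : Set
      SizeSelectable =
        ∃[ sizeSelect ] ∃[ c ] ∃[ k ] ∀ m → (∃[ x ] sz x ≡ m) →
          ∃[ μ ] sizeSelect ⊢ num (fromℕ m) ⇓ μ
               × (∀ x → Pr (_≟V to x) μ ≡ conditional T (λ z → sz z ℕ.≟ m) x)
               × TimeAtMost (poly c k (fromℕ m)) μ

      SizeProbComputable : Set
      SizeProbComputable =
        ∃[ probT ] ∃[ c ] ∃[ k ] ∀ m →
          ReturnsWithin probT (num (fromℕ m)) (num (mass T (λ x → sz x ≡ m)))
                        (poly c k (fromℕ m))

      MaxLenComputable : Set
      MaxLenComputable =
        ∃[ maxLen ] ∃[ c ] ∃[ k ] ∃[ C ] ∃[ j ] ∀ δ → 0# < δ → δ < 1# →
          ∃[ M ] mass T (λ x → M ℕ.< sz x) ≤ δ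
               × fromℕ M ≤ C * (δ ⁻¹) ^ j
               × ReturnsWithin maxLen (num δ) (num (fromℕ M)) (poly c k (δ ⁻¹))

    LocallyTractable : Set
    LocallyTractable =
      ∃[ sz ] IsSizeFunction sz × SizeSelectable sz
            × SizeProbComputable sz × MaxLenComputable sz

{-# OPTIONS --safe #-}
module Submission where

-- Let sz be the size function of a locally tractable distribution T and write
-- p(m) = T(sz⁻¹(m)).  Given δ, the number M returned by maxLen bounds the sizes
-- of all elements outside a set of mass at most δ, so the finite set
-- F = {x : sz x ≤ M} can serve for the truncation.  To sample from T^F, the
-- algorithm tabulates p(0), …, p(M) by calls of probT, chooses a size m ≤ M with
-- probability p(m), or ⊥ with the remaining probability 1 - p(0) - … - p(M),
-- and in the first case calls sizeSelect on m.
--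
-- An x of size m ≤ M is output with probability p(m) · T(x)/p(m) = T(x)
-- (level-share, branches⇓), and ⊥ with probability 1 - T(F), since the mass of
-- a finite set is a finite sum and F is the disjoint union of its levels
-- (mass-initialSegment).  Sizes with p(m) = 0 need no sampling: an element of
-- Dom T has positive probability, so p(m) = 0 exactly if no element has size m
-- (inhabited⇒levelMass≢0, levelMass≢0⇒inhabited), and the machine never takes
-- branches of probability 0.
--
-- The algorithm is deterministic until the choice from the table (table⇓), so F
-- is the same in every invocation and the static variable can stay empty.
--
-- As for time, 1/δ ≥ 1 and M is at most polynomial in 1/δ; the running time is
-- a sum of products of polynomials in M and 1/δ, and functions of polynomial
-- growth on [1,∞) are closed under these operations (PolyGrowth).

open import Defs
open import Algebra.Bundles using (CommutativeRing)
import Algebra.Properties.CommutativeSemigroup as CommutativeSemigroupProperties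
import Algebra.Properties.CommutativeSemiring.Exp as Exp
import Algebra.Properties.Monoid.Mult as Mult
import Algebra.Properties.Ring as RingProperties
import Data.Empty.Irrelevant as Irrelevant
open import Data.Irrelevant using (Irrelevant) renaming ([_] to irrelevant)
open import Data.List.Base
  using ( List; []; _∷_; [_]; _++_; map; filter; length; cartesianProductWith; concatMap
        ; deduplicate; upTo)
open import Data.List.Properties
  using ( map-∘; map-cong; map-++; ++-assoc; ++-identityʳ; length-map; length-upTo; upTo-∷ʳ
        ; filter-++; filter-none)
import Data.List.Membership.DecPropositional as DecMembership
open import Data.List.Membership.Propositional using (_∈_; _∉_)
open import Data.List.Membership.Propositional.Properties
  using ( ∈-∃++; ∈-++⁺ˡ; ∈-++⁺ʳ; ∈-++⁻; ∈-filter⁺; ∈-filter⁻; ∈-deduplicate⁺; ∈-deduplicate⁻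
        ; ∈-concatMap⁺; ∈-concatMap⁻; ∈-upTo⁺; ∈-upTo⁻)
open import Data.List.Relation.Binary.Subset.Propositional using (_⊆_)
open import Data.List.Relation.Unary.All as All using (All; []; _∷_)
import Data.List.Relation.Unary.All.Properties as All
open import Data.List.Relation.Unary.AllPairs as AllPairs using ([]; _∷_)
import Data.List.Relation.Unary.AllPairs.Properties as AllPairs
open import Data.List.Relation.Unary.Any as Any using (here; there)
import Data.List.Relation.Unary.Unique.DecPropositional.Properties as DecUnique
open import Data.List.Relation.Unary.Unique.Propositional using (Unique)
open import Data.List.Relation.Unary.Unique.Propositional.Properties as Unique
  using (Unique[x∷xs]⇒x∉xs)
open import Data.Maybe.Base using (just; nothing)
open import Data.Nat.Base as ℕ using (ℕ; zero; suc)
import Data.Nat.Properties as ℕ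
open import Data.Product.Base using (∃-syntax; _×_; _,_; proj₁; proj₂)
open import Data.Refinement using (value; proof)
import Data.Refinement.Properties as Refinement
open import Data.Sum.Base using (inj₁; inj₂)
open import Data.Unit.Base using (tt)
open import Function.Base using (_∘_; id)
open import Function.Bundles using (_↣_; _⇔_; mk⇔; module Equivalence; module Injection)
open import Relation.Binary.Bundles using (Poset)
open import Relation.Binary.PropositionalEquality
  using (_≡_; _≢_; refl; sym; trans; cong; cong₂; subst; subst₂; module ≡-Reasoning)
import Relation.Binary.Reasoning.PartialOrder as PosetReasoning
open import Relation.Binary.Structures using (IsDecTotalOrder)
open import Relation.Nullary using (¬_; yes; no; contradiction)
open import Relation.Unary using (Decidable)

-- Ordered-field arithmetic and polynomial growth

module RealProperties (R : Reals) where
  open Reals R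
  open CommutativeRing commutativeRing public
    using ( +-assoc; +-comm; +-identityˡ; +-identityʳ; -‿inverseˡ; -‿inverseʳ
          ; *-assoc; *-comm; *-identityˡ; *-identityʳ; distribˡ; distribʳ
          ; zeroˡ; zeroʳ; ring; commutativeSemiring; +-monoid; *-commutativeSemigroup)
  open IsDecTotalOrder isDecTotalOrder public
    using (antisym; isPartialOrder)
    renaming (total to ≤-total; refl to ≤-refl; trans to ≤-trans; reflexive to ≤-reflexive)
  open Exp commutativeSemiring using (^-homo-*)
  open CommutativeSemigroupProperties *-commutativeSemigroup using ()
    renaming (interchange to *-interchange)
  open RingProperties ring using (-‿distribʳ-*; -‿distribˡ-*; -‿involutive; -‿+-comm)

  ≤-poset : Poset _ _ _
  ≤-poset = record { isPartialOrder = isPartialOrder }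

  module ≤-Reasoning = PosetReasoning ≤-poset

  +-monoʳ-≤ : ∀ z {x y} → x ≤ y → z + x ≤ z + y
  +-monoʳ-≤ z {x} {y} x≤y = subst₂ _≤_ (+-comm x z) (+-comm y z) (+-monoˡ-≤ z x≤y)

  +-mono-≤ : ∀ {x y u v} → x ≤ y → u ≤ v → x + u ≤ y + v
  +-mono-≤ {y = y} {u} x≤y u≤v = ≤-trans (+-monoˡ-≤ u x≤y) (+-monoʳ-≤ y u≤v)

  +-nonneg : ∀ {x y} → 0# ≤ x → 0# ≤ y → 0# ≤ x + y
  +-nonneg 0≤x 0≤y = ≤-trans (≤-reflexive (sym (+-identityˡ 0#))) (+-mono-≤ 0≤x 0≤y)

  x≤x+y : ∀ {x y} → 0# ≤ y → x ≤ x + y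
  x≤x+y {x} 0≤y = ≤-trans (≤-reflexive (sym (+-identityʳ x))) (+-monoʳ-≤ x 0≤y)

  x-y+y≡x : ∀ x y → (x - y) + y ≡ x
  x-y+y≡x x y = trans (+-assoc x (- y) y)
                      (trans (cong (x +_) (-‿inverseˡ y)) (+-identityʳ x))

  x≤y⇒0≤y-x : ∀ {x y} → x ≤ y → 0# ≤ y - x
  x≤y⇒0≤y-x {x} x≤y = subst (_≤ _) (-‿inverseʳ x) (+-monoˡ-≤ (- x) x≤y)

  0≤y-x⇒x≤y : ∀ {x y} → 0# ≤ y - x → x ≤ y
  0≤y-x⇒x≤y {x} {y} p = subst₂ _≤_ (+-identityˡ x) (x-y+y≡x y x) (+-monoˡ-≤ x p)

  *-distribˡ-minus : ∀ z y x → z * (y - x) ≡ z * y - z * x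
  *-distribˡ-minus z y x =
    trans (distribˡ z y (- x)) (cong (z * y +_) (sym (-‿distribʳ-* z x)))

  *-monoˡ-≤ : ∀ {z x y} → 0# ≤ z → x ≤ y → z * x ≤ z * y
  *-monoˡ-≤ {z} {x} {y} 0≤z x≤y = 0≤y-x⇒x≤y
    (subst (0# ≤_) (*-distribˡ-minus z y x) (*-nonneg 0≤z (x≤y⇒0≤y-x x≤y)))

  *-monoʳ-≤ : ∀ {z x y} → 0# ≤ z → x ≤ y → x * z ≤ y * z
  *-monoʳ-≤ {z} {x} {y} 0≤z x≤y =
    subst₂ _≤_ (*-comm z x) (*-comm z y) (*-monoˡ-≤ 0≤z x≤y)

  *-mono-≤ : ∀ {x y u v} → 0# ≤ y → 0# ≤ u → x ≤ y → u ≤ v → x * u ≤ y * v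
  *-mono-≤ 0≤y 0≤u x≤y u≤v = ≤-trans (*-monoʳ-≤ 0≤u x≤y) (*-monoˡ-≤ 0≤y u≤v)

  -- If 1 ≤ 0 then 0 ≤ - 1, so 0 ≤ (- 1) * (- 1) = 1 all the same.
  0≤1 : 0# ≤ 1#
  0≤1 with ≤-total 0# 1#
  ... | inj₁ 0≤1 = 0≤1
  ... | inj₂ 1≤0 = subst (0# ≤_) square (*-nonneg 0≤-1 0≤-1)
    where
    0≤-1 : 0# ≤ - 1#
    0≤-1 = subst (0# ≤_) (+-identityˡ (- 1#)) (x≤y⇒0≤y-x 1≤0)
    square : (- 1#) * (- 1#) ≡ 1#
    square = trans (sym (-‿distribˡ-* 1# (- 1#)))
                   (trans (cong -_ (*-identityˡ (- 1#))) (-‿involutive 1#))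

  0≰-1 : ¬ 0# ≤ 0# - 1#
  0≰-1 p = 0≢1 (antisym 0≤1 (0≤y-x⇒x≤y p))

  1≤⇒0≤ : ∀ {x} → 1# ≤ x → 0# ≤ x
  1≤⇒0≤ = ≤-trans 0≤1

  x≤x*y : ∀ {x y} → 0# ≤ x → 1# ≤ y → x ≤ x * y
  x≤x*y {x} 0≤x 1≤y = ≤-trans (≤-reflexive (sym (*-identityʳ x))) (*-monoˡ-≤ 0≤x 1≤y)

  1≤x⁻¹ : ∀ {x} → 0# < x → x < 1# → 1# ≤ x ⁻¹
  1≤x⁻¹ {x} (0≤x , 0≢x) (x≤1 , x≢1) with ≤-total 1# (x ⁻¹)
  ... | inj₁ p = p
  ... | inj₂ p = contradiction (antisym x≤1 1≤x) x≢1
    where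
    1≤x : 1# ≤ x
    1≤x = subst₂ _≤_ (*-inverseʳ x (0≢x ∘ sym)) (*-identityʳ x) (*-monoˡ-≤ 0≤x p)

  *-cancel-/ : ∀ x {y} → y ≢ 0# → y * (x / y) ≡ x
  *-cancel-/ x {y} y≢0 = begin
    y * (x * y ⁻¹)  ≡⟨ cong (y *_) (*-comm x (y ⁻¹)) ⟩
    y * (y ⁻¹ * x)  ≡⟨ *-assoc y (y ⁻¹) x ⟨
    y * y ⁻¹ * x    ≡⟨ cong (_* x) (*-inverseʳ y y≢0) ⟩
    1# * x          ≡⟨ *-identityˡ x ⟩
    x               ∎
    where open ≡-Reasoning

  [x-y]-z≡x-[z+y] : ∀ x y z → (x - y) - z ≡ x - (z + y)
  [x-y]-z≡x-[z+y] x y z = trans (+-assoc x (- y) (- z))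
    (cong (x +_) (trans (-‿+-comm y z) (cong -_ (+-comm y z))))

  ^-nonneg : ∀ {x} k → 0# ≤ x → 0# ≤ x ^ k
  ^-nonneg zero    0≤x = 0≤1
  ^-nonneg (suc k) 0≤x = *-nonneg 0≤x (^-nonneg k 0≤x)

  ^-monoˡ-≤ : ∀ {x y} k → 0# ≤ x → x ≤ y → x ^ k ≤ y ^ k
  ^-monoˡ-≤ zero    0≤x x≤y = ≤-refl
  ^-monoˡ-≤ (suc k) 0≤x x≤y =
    *-mono-≤ (≤-trans 0≤x x≤y) (^-nonneg k 0≤x) x≤y (^-monoˡ-≤ k 0≤x x≤y)

  1≤x^k : ∀ {x} k → 1# ≤ x → 1# ≤ x ^ k
  1≤x^k zero    1≤x = ≤-refl
  1≤x^k (suc k) 1≤x = ≤-trans 1≤x (x≤x*y (1≤⇒0≤ 1≤x) (1≤x^k k 1≤x))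

  fromℕ-+ : ∀ m n → fromℕ (m ℕ.+ n) ≡ fromℕ m + fromℕ n
  fromℕ-+ = Mult.×-homo-+ +-monoid 1#

  fromℕ-+-≤ : ∀ m n {a b} → fromℕ m ≤ a → fromℕ n ≤ b → fromℕ (m ℕ.+ n) ≤ a + b
  fromℕ-+-≤ m n m≤a n≤b = ≤-trans (≤-reflexive (fromℕ-+ m n)) (+-mono-≤ m≤a n≤b)

  fromℕ-nonneg : ∀ n → 0# ≤ fromℕ n
  fromℕ-nonneg zero    = ≤-refl
  fromℕ-nonneg (suc n) = +-nonneg 0≤1 (fromℕ-nonneg n)

  fromℕ-mono-≤ : ∀ {m n} → m ℕ.≤ n → fromℕ m ≤ fromℕ n
  fromℕ-mono-≤ {n = n} ℕ.z≤n       = fromℕ-nonneg n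
  fromℕ-mono-≤         (ℕ.s≤s m≤n) = +-monoʳ-≤ 1# (fromℕ-mono-≤ m≤n)

  fromℕ-pred : ∀ n → fromℕ (suc n) - 1# ≡ fromℕ n
  fromℕ-pred n = trans (cong (_- 1#) (+-comm 1# (fromℕ n)))
    (trans (+-assoc (fromℕ n) 1# (- 1#))
      (trans (cong (fromℕ n +_) (-‿inverseʳ 1#)) (+-identityʳ (fromℕ n))))

  -- f is of at most polynomial growth: 0 ≤ f x ≤ c x^k for all x ≥ 1.  On
  -- [1,∞) the additive constant of poly can be absorbed into c.  The lower
  -- bound makes the class closed under multiplication.
  PolyGrowth : (ℝ → ℝ) → Set
  PolyGrowth f =
    ∃[ c ] ∃[ k ] 0# ≤ c × (∀ x → 1# ≤ x → 0# ≤ f x × f x ≤ c * x ^ k)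

  const-growth : ∀ {a} → 0# ≤ a → PolyGrowth (λ _ → a)
  const-growth {a} 0≤a = a , 0 , 0≤a , λ _ _ →
    0≤a , ≤-reflexive (sym (*-identityʳ a))

  id-growth : PolyGrowth (λ x → x)
  id-growth = 1# , 1 , 0≤1 , λ x 1≤x → 1≤⇒0≤ 1≤x ,
    ≤-reflexive (sym (trans (*-identityˡ (x * 1#)) (*-identityʳ x)))

  +-growth : ∀ {f g} → PolyGrowth f → PolyGrowth g → PolyGrowth (λ x → f x + g x)
  +-growth {f} {g} (c , k , 0≤c , f≤) (d , l , 0≤d , g≤) =
    c + d , k ℕ.+ l , +-nonneg 0≤c 0≤d , λ x 1≤x →
      let 0≤x = 1≤⇒0≤ 1≤x; 0≤fx , fx≤ = f≤ x 1≤x; 0≤gx , gx≤ = g≤ x 1≤x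
          open ≤-Reasoning
      in +-nonneg 0≤fx 0≤gx , (begin
        f x + g x                                  ≤⟨ +-mono-≤ fx≤ gx≤ ⟩
        c * x ^ k + d * x ^ l                      ≤⟨ +-mono-≤
          (*-monoˡ-≤ 0≤c (x≤x*y (^-nonneg k 0≤x) (1≤x^k l 1≤x)))
          (*-monoˡ-≤ 0≤d (x≤x*y (^-nonneg l 0≤x) (1≤x^k k 1≤x))) ⟩
        c * (x ^ k * x ^ l) + d * (x ^ l * x ^ k)  ≡⟨ cong (λ z → c * (x ^ k * x ^ l) + d * z)
                                                           (*-comm (x ^ l) (x ^ k)) ⟩
        c * (x ^ k * x ^ l) + d * (x ^ k * x ^ l)  ≡⟨ distribʳ (x ^ k * x ^ l) c d ⟨
        (c + d) * (x ^ k * x ^ l)                  ≡⟨ cong ((c + d) *_) (^-homo-* x k l) ⟨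
        (c + d) * x ^ (k ℕ.+ l)                    ∎)

  *-growth : ∀ {f g} → PolyGrowth f → PolyGrowth g → PolyGrowth (λ x → f x * g x)
  *-growth {f} {g} (c , k , 0≤c , f≤) (d , l , 0≤d , g≤) =
    c * d , k ℕ.+ l , *-nonneg 0≤c 0≤d , λ x 1≤x →
      let 0≤x = 1≤⇒0≤ 1≤x; 0≤fx , fx≤ = f≤ x 1≤x; 0≤gx , gx≤ = g≤ x 1≤x
          open ≤-Reasoning
      in *-nonneg 0≤fx 0≤gx , (begin
        f x * g x                  ≤⟨ *-mono-≤ (*-nonneg 0≤c (^-nonneg k 0≤x)) 0≤gx fx≤ gx≤ ⟩
        (c * x ^ k) * (d * x ^ l)  ≡⟨ *-interchange c (x ^ k) d (x ^ l) ⟩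
        (c * d) * (x ^ k * x ^ l)  ≡⟨ cong ((c * d) *_) (^-homo-* x k l) ⟨
        (c * d) * x ^ (k ℕ.+ l)    ∎)

  ^-growth : ∀ {f} → PolyGrowth f → ∀ n → PolyGrowth (λ x → f x ^ n)
  ^-growth f-growth zero    = const-growth 0≤1
  ^-growth f-growth (suc n) = *-growth f-growth (^-growth f-growth n)

  poly-growth : ∀ {c f} k → 0# ≤ c → PolyGrowth f → PolyGrowth (λ x → poly R c k (f x))
  poly-growth k 0≤c f-growth =
    +-growth (*-growth (const-growth 0≤c) (^-growth f-growth k)) (const-growth 0≤c)

  poly-nonneg : ∀ {c x} k → 0# ≤ c → 0# ≤ x → 0# ≤ poly R c k x
  poly-nonneg k 0≤c 0≤x = +-nonneg (*-nonneg 0≤c (^-nonneg k 0≤x)) 0≤c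

  -- max(0, c).  The constant of a bound poly c k comes without a sign; poly c k
  -- need not be monotone if c < 0.
  positivePart : ℝ → ℝ
  positivePart c with 0# ≤? c
  ... | yes _ = c
  ... | no  _ = 0#

  0≤positivePart : ∀ c → 0# ≤ positivePart c
  0≤positivePart c with 0# ≤? c
  ... | yes 0≤c = 0≤c
  ... | no  _   = ≤-refl

  ≤positivePart : ∀ c → c ≤ positivePart c
  ≤positivePart c with 0# ≤? c | ≤-total 0# c
  ... | yes _   | _         = ≤-refl
  ... | no  0≰c | inj₁ 0≤c  = contradiction 0≤c 0≰c
  ... | no  _   | inj₂ c≤0  = c≤0

  poly-mono : ∀ {c x y} k → 0# ≤ x → x ≤ y → poly R c k x ≤ poly R (positivePart c) k y
  poly-mono {c} {x} {y} k 0≤x x≤y = +-mono-≤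
    (*-mono-≤ (0≤positivePart c) (^-nonneg k 0≤x) (≤positivePart c) (^-monoˡ-≤ k 0≤x x≤y))
    (≤positivePart c)

-- Finite sums

module FiniteSums (R : Reals) where
  open Reals R
  open RealProperties R

  sum-++ : ∀ xs ys → sum (xs ++ ys) ≡ sum xs + sum ys
  sum-++ []       ys = sym (+-identityˡ (sum ys))
  sum-++ (x ∷ xs) ys = trans (cong (x +_) (sum-++ xs ys)) (sym (+-assoc x (sum xs) (sum ys)))

  module _ {A : Set} (f : A → ℝ) where

    sum-map-++ : ∀ xs ys → sum (map f (xs ++ ys)) ≡ sum (map f xs) + sum (map f ys)
    sum-map-++ xs ys = trans (cong sum (map-++ f xs ys)) (sum-++ (map f xs) (map f ys))

    sum-map-insert : ∀ x xs ys → sum (map f (xs ++ x ∷ ys)) ≡ f x + sum (map f (xs ++ ys))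
    sum-map-insert x xs ys = begin
      sum (map f (xs ++ x ∷ ys))                   ≡⟨ sum-map-++ xs (x ∷ ys) ⟩
      sum (map f xs) + (f x + sum (map f ys))      ≡⟨ +-assoc (sum (map f xs)) (f x) _ ⟨
      (sum (map f xs) + f x) + sum (map f ys)      ≡⟨ cong (_+ sum (map f ys))
                                                           (+-comm (sum (map f xs)) (f x)) ⟩
      (f x + sum (map f xs)) + sum (map f ys)      ≡⟨ +-assoc (f x) _ _ ⟩
      f x + (sum (map f xs) + sum (map f ys))      ≡⟨ cong (f x +_) (sum-map-++ xs ys) ⟨
      f x + sum (map f (xs ++ ys))                 ∎
      where open ≡-Reasoning

    sum-concatMap : {B : Set} (g : B → List A) (bs : List B) →
                    sum (map f (concatMap g bs)) ≡ sum (map (λ b → sum (map f (g b))) bs)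
    sum-concatMap g []       = refl
    sum-concatMap g (b ∷ bs) =
      trans (sum-map-++ (g b) (concatMap g bs)) (cong (sum (map f (g b)) +_) (sum-concatMap g bs))

    module _ (f≥0 : ∀ x → 0# ≤ f x) where

      sum-map-nonneg : ∀ xs → 0# ≤ sum (map f xs)
      sum-map-nonneg []       = ≤-refl
      sum-map-nonneg (x ∷ xs) = +-nonneg (f≥0 x) (sum-map-nonneg xs)

      sum-map-mono-⊆ : ∀ {xs} ys → Unique ys → ys ⊆ xs → sum (map f ys) ≤ sum (map f xs)
      -- By induction on ys: its first element is removed from xs as well.
      sum-map-mono-⊆ {xs} []       _                 _ = sum-map-nonneg xs
      sum-map-mono-⊆ {xs} (y ∷ ys) u@(_ ∷ ys-unique) y∷ys⊆xs
        with as , bs , refl ← ∈-∃++ (y∷ys⊆xs (here refl)) =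
        ≤-trans (+-monoʳ-≤ (f y) (sum-map-mono-⊆ ys ys-unique ys⊆as++bs))
                (≤-reflexive (sym (sum-map-insert y as bs)))
        where
        ys⊆as++bs : ys ⊆ as ++ bs
        ys⊆as++bs z∈ys with ∈-++⁻ as (y∷ys⊆xs (there z∈ys))
        ... | inj₁ z∈as         = ∈-++⁺ˡ z∈as
        ... | inj₂ (here refl)  = contradiction z∈ys (Unique[x∷xs]⇒x∉xs u)
        ... | inj₂ (there z∈bs) = ∈-++⁺ʳ as z∈bs

  -- v if m = n, and 0 otherwise; summing over m picks out the term at n.
  indicator : ℝ → ℕ → ℕ → ℝ
  indicator v n m with n ℕ.≟ m
  ... | yes _ = v
  ... | no  _ = 0#

  sum-indicator-∉ : ∀ v n ms → n ∉ ms → sum (map (indicator v n) ms) ≡ 0#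
  sum-indicator-∉ v n []       _ = refl
  sum-indicator-∉ v n (m ∷ ms) n∉ with n ℕ.≟ m
  ... | yes refl = contradiction (here refl) n∉
  ... | no  _    = trans (+-identityˡ _) (sum-indicator-∉ v n ms (n∉ ∘ there))

  sum-indicator-∈ : ∀ v n {ms} → Unique ms → n ∈ ms → sum (map (indicator v n) ms) ≡ v
  sum-indicator-∈ v n {m ∷ ms} u@(_ ∷ ms-unique) n∈ with n ℕ.≟ m | n∈
  ... | yes refl | _          = trans (cong (v +_) (sum-indicator-∉ v n ms (Unique[x∷xs]⇒x∉xs u)))
                                      (+-identityʳ v)
  ... | no  n≢m  | here n≡m   = contradiction n≡m n≢m
  ... | no  _    | there n∈ms = trans (+-identityˡ _) (sum-indicator-∈ v n ms-unique n∈ms)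

-- Running programs

module Runs (R : Reals) where
  open Reals R
  open RealProperties R
  open FiniteSums R

  infix 4 _▷_⇓_ _▷_↦_⟨_⟩

  -- The evaluation relation of the machine over R.
  _▷_⇓_ : Prog R → Val R → Outcomes R → Set
  _▷_⇓_ = _⊢_⇓_ R

  -- A run without random choices, with result r, in exactly t steps.
  _▷_↦_⟨_⟩ : Prog R → Val R → Val R → ℕ → Set
  p ▷ v ↦ r ⟨ t ⟩ = p ▷ v ⇓ pure R t r

  -- The effect on an outcome of t earlier deterministic steps.
  delay : ℕ → Outcome R → Outcome R
  delay t (outcome w c v) = outcome w (t ℕ.+ c) v

  -- The effect on an outcome of pairing the result with nil: one step for nil
  -- and one for the pair.
  attachNil : Outcome R → Outcome R
  attachNil (outcome w c v) = outcome w (2 ℕ.+ c) (cons v nil)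

  returning : ∀ {p v r r′ t} → r ≡ r′ → p ▷ v ↦ r ⟨ t ⟩ → p ▷ v ↦ r′ ⟨ t ⟩
  returning refl p⇓ = p⇓

  seq : ∀ {p q v u t μ} → p ▷ v ↦ u ⟨ t ⟩ → q ▷ u ⇓ μ → (p ⨟ q) ▷ v ⇓ map (delay t) μ
  seq {p} {q} {v} {u} {t} {μ} p⇓ q⇓ =
    subst ((p ⨟ q) ▷ v ⇓_) (after-pure μ) (⇓seq p⇓ (q⇓ ∷ []))
    where
    after-pure : ∀ μ → map (after R (outcome 1# t u)) μ ++ [] ≡ map (delay t) μ
    after-pure []                  = refl
    after-pure (outcome w c r ∷ μ) =
      cong₂ _∷_ (cong (λ z → outcome z (t ℕ.+ c) r) (*-identityˡ w)) (after-pure μ)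

  pair : ∀ {p q v a b t t′} → p ▷ v ↦ a ⟨ t ⟩ → q ▷ v ↦ b ⟨ t′ ⟩ →
         pairP p q ▷ v ↦ cons a b ⟨ suc (t ℕ.+ t′) ⟩
  pair {p} {q} {v} {a} {b} {t} {t′} p⇓ q⇓ =
    subst (λ w → pairP p q ▷ v ⇓ [ outcome w (suc (t ℕ.+ t′)) (cons a b) ]) (*-identityˡ 1#)
          (⇓pair p⇓ q⇓)

  pair-nil : ∀ {p v μ} → p ▷ v ⇓ μ → pairP p nilP ▷ v ⇓ map attachNil μ
  pair-nil {p} {v} {μ} p⇓ = subst (pairP p nilP ▷ v ⇓_) (attach μ) (⇓pair p⇓ ⇓nil)
    where
    attach : ∀ μ → cartesianProductWith (pairOutcome R) μ (pure R 1 nil) ≡ map attachNil μ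
    attach []                  = refl
    attach (outcome w c r ∷ μ) =
      cong₂ _∷_ (cong₂ (λ z t → outcome z (suc t) (cons r nil)) (*-identityʳ w) (ℕ.+-comm c 1))
                (attach μ)

  while-step : ∀ {p b v s r t t′} → b ≢ nil → p ▷ v ↦ s ⟨ t ⟩ → while p ▷ s ↦ r ⟨ t′ ⟩ →
               while p ▷ cons b v ↦ r ⟨ suc (t ℕ.+ t′) ⟩
  while-step {p} {b} {v} {s} {r} {t} {t′} b≢nil p⇓ w⇓ =
    subst (λ w → while p ▷ cons b v ⇓ [ outcome w (suc (t ℕ.+ t′)) r ]) (*-identityˡ 1#)
          (⇓step b≢nil p⇓ (w⇓ ∷ []))

  module _ {P : Val R → Set} (P? : Decidable P) where

    Pr-++ : ∀ μ ν → Pr R P? (μ ++ ν) ≡ Pr R P? μ + Pr R P? ν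
    Pr-++ μ ν = trans (cong (sum ∘ map weight) (filter-++ (P? ∘ result) μ ν))
                      (sum-map-++ weight (filter (P? ∘ result) μ) _)

    Pr-none : ∀ {μ} → All (¬_ ∘ P ∘ result) μ → Pr R P? μ ≡ 0#
    Pr-none none = cong (sum ∘ map weight) (filter-none (P? ∘ result) none)

    -- If f scales weights by w and turns the event Q into the event P, then it
    -- scales the probability by w.
    Pr-map : ∀ {Q : Val R → Set} (Q? : Decidable Q) {f : Outcome R → Outcome R} {w} →
             (∀ o → weight (f o) ≡ w * weight o) →
             (∀ o → P (result (f o)) ⇔ Q (result o)) →
             ∀ μ → Pr R P? (map f μ) ≡ w * Pr R Q? μ
    Pr-map Q? {w = w} scaled P⇔Q []      = sym (zeroʳ w)
    Pr-map Q? {f} {w} scaled P⇔Q (o ∷ μ) with P? (result (f o)) | Q? (result o)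
    ... | yes _  | yes _ = trans (cong₂ _+_ (scaled o) (Pr-map Q? scaled P⇔Q μ))
                                 (sym (distribˡ w _ _))
    ... | no  _  | no  _ = Pr-map Q? scaled P⇔Q μ
    ... | yes Pv | no ¬Q = contradiction (Equivalence.to (P⇔Q o) Pv) ¬Q
    ... | no ¬P  | yes q = contradiction (Equivalence.from (P⇔Q o) q) ¬P

    Pr-delay : ∀ t μ → Pr R P? (map (delay t) μ) ≡ Pr R P? μ
    Pr-delay t μ =
      trans (Pr-map P? (λ o → sym (*-identityˡ (weight o))) (λ _ → mk⇔ id id) μ) (*-identityˡ _)

-- Masses of finite sets and of levels

module Masses (R : Reals) {A : Set} (T : Distribution R A) where
  open Reals R
  open RealProperties R
  open FiniteSums R
  open Distribution T

  prob-nonneg : ∀ x → 0# ≤ prob R T x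
  prob-nonneg x = pr≥0 (value x)

  -- Elements of Dom carry an irrelevant proof of positivity; it may be used
  -- here because the conclusion is a negation.
  prob≢0 : ∀ x → prob R T x ≢ 0#
  prob≢0 x px≡0 = pos (proof x)
    where
    pos : Irrelevant (0# < prob R T x) → _
    pos (irrelevant p) = Irrelevant.⊥-elim (proj₂ p (sym px≡0))

  mass-mono : ∀ {L L′} → (∀ x → L x → L′ x) → mass R T L ≤ mass R T L′
  mass-mono {L} {L′} L⊆L′ = proj₂ (proj₂ (massSum R T L)) (mass R T L′) λ
    { _ (partial xs u all) →
          proj₁ (proj₂ (massSum R T L′)) _ (partial xs u (All.map (L⊆L′ _) all)) }

  mass≤1 : ∀ L → mass R T L ≤ 1#
  mass≤1 L = proj₂ (proj₂ (massSum R T L)) 1# λ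
    { _ (partial xs u _) → subst (_≤ 1#) (cong sum (sym (map-∘ {g = pr} {f = value} xs)))
          (proj₁ total _ (partial (map value xs)
            (Unique.map⁺ Refinement.value-injective u) (All.universal (λ _ → tt) _))) }

  -- On a finite set the supremum of the partial sums is the sum over the
  -- whole set.
  mass-finite : ∀ {L xs} → Unique xs → (∀ {x} → x ∈ xs ⇔ L x) →
                mass R T L ≡ sum (map (prob R T) xs)
  mass-finite {L} {xs} u enum = antisym
    (proj₂ (proj₂ (massSum R T L)) _ λ
      { _ (partial ys v all) → sum-map-mono-⊆ (prob R T) prob-nonneg ys v
          (λ y∈ys → Equivalence.from enum (All.lookup all y∈ys)) })
    (proj₁ (proj₂ (massSum R T L)) _ (partial xs u (All.tabulate (Equivalence.to enum))))

  truncate-∈ : ∀ {F x} → x ∈ F → truncate R T F (just x) ≡ prob R T x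
  truncate-∈ {F} {x} x∈F with DecMembership._∈?_ (_≟D_ R T) x F
  ... | yes _   = refl
  ... | no  x∉F = contradiction x∈F x∉F

  truncate-∉ : ∀ {F x} → x ∉ F → truncate R T F (just x) ≡ 0#
  truncate-∉ {F} {x} x∉F with DecMembership._∈?_ (_≟D_ R T) x F
  ... | yes x∈F = contradiction x∈F x∉F
  ... | no  _   = refl

  module Levels (sz : Dom R T → ℕ) (finite : ∀ m → ∃[ xs ] (∀ x → sz x ≡ m → x ∈ xs)) where

    -- sz⁻¹(m), listed without repetition.
    level : ℕ → List (Dom R T)
    level m = deduplicate (_≟D_ R T) (filter (λ x → sz x ℕ.≟ m) (proj₁ (finite m)))

    ∈-level : ∀ {m x} → x ∈ level m ⇔ sz x ≡ m
    ∈-level {m} {x} = mk⇔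
      (λ x∈ → proj₂ (∈-filter⁻ (λ x → sz x ℕ.≟ m) {xs = proj₁ (finite m)}
                       (∈-deduplicate⁻ (_≟D_ R T) _ x∈)))
      (λ eq → ∈-deduplicate⁺ (_≟D_ R T)
                (∈-filter⁺ (λ x → sz x ℕ.≟ m) (proj₂ (finite m) x eq) eq))

    level-unique : ∀ m → Unique (level m)
    level-unique m = DecUnique.deduplicate-! (_≟D_ R T) _

    -- T(sz⁻¹(m))
    levelMass : ℕ → ℝ
    levelMass m = mass R T (λ x → sz x ≡ m)

    levelMass-sum : ∀ m → levelMass m ≡ sum (map (prob R T) (level m))
    levelMass-sum m = mass-finite (level-unique m) ∈-level

    levelMass-nonneg : ∀ m → 0# ≤ levelMass m
    levelMass-nonneg m = subst (0# ≤_) (sym (levelMass-sum m))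
                           (sum-map-nonneg (prob R T) prob-nonneg (level m))

    levelMass≢0⇒inhabited : ∀ m → levelMass m ≢ 0# → ∃[ x ] sz x ≡ m
    levelMass≢0⇒inhabited m p≢0 = inhabited (level m) refl
      where
      inhabited : ∀ xs → level m ≡ xs → ∃[ x ] sz x ≡ m
      inhabited []      eq =
        contradiction (trans (levelMass-sum m) (cong (sum ∘ map (prob R T)) eq)) p≢0
      inhabited (x ∷ _) eq = x , Equivalence.to ∈-level (subst (x ∈_) (sym eq) (here refl))

    inhabited⇒levelMass≢0 : ∀ x → levelMass (sz x) ≢ 0#
    inhabited⇒levelMass≢0 x p≡0 = prob≢0 x (antisym prob≤0 (prob-nonneg x))
      where
      x⊆level : x ∷ [] ⊆ level (sz x)
      x⊆level (here refl) = Equivalence.from ∈-level refl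
      prob≤0 : prob R T x ≤ 0#
      prob≤0 = subst₂ _≤_ (+-identityʳ _) (trans (sym (levelMass-sum (sz x))) p≡0)
                 (sum-map-mono-⊆ (prob R T) prob-nonneg (x ∷ []) ([] ∷ []) x⊆level)

    -- The elements of size at most M, listed without repetition: the set F of
    -- the truncated distribution.
    initialSegment : ℕ → List (Dom R T)
    initialSegment M = concatMap level (upTo (suc M))

    ∈-initialSegment : ∀ {M x} → x ∈ initialSegment M ⇔ sz x ∈ upTo (suc M)
    ∈-initialSegment {M} {x} = mk⇔
      (λ x∈ → Any.map (Equivalence.to ∈-level) (∈-concatMap⁻ level x∈))
      (λ sz∈ → ∈-concatMap⁺ level (Any.map (Equivalence.from ∈-level) sz∈))

    initialSegment-unique : ∀ M → Unique (initialSegment M)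
    initialSegment-unique M = Unique.concat⁺
      (All.map⁺ (All.universal level-unique _))
      (AllPairs.map⁺ (AllPairs.map disjoint (Unique.upTo⁺ (suc M))))
      where
      disjoint : ∀ {m n} → m ≢ n → ∀ {x} → ¬ (x ∈ level m × x ∈ level n)
      disjoint m≢n (x∈m , x∈n) =
        m≢n (trans (sym (Equivalence.to ∈-level x∈m)) (Equivalence.to ∈-level x∈n))

    mass-initialSegment : ∀ M → mass R T (_∈ initialSegment M) ≡ sum (map levelMass (upTo (suc M)))
    mass-initialSegment M = begin
      mass R T (_∈ initialSegment M)
        ≡⟨ mass-finite (initialSegment-unique M) (mk⇔ id id) ⟩
      sum (map (prob R T) (initialSegment M))
        ≡⟨ sum-concatMap (prob R T) level (upTo (suc M)) ⟩
      sum (map (λ m → sum (map (prob R T) (level m))) (upTo (suc M)))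
        ≡⟨ cong sum (map-cong (λ m → sym (levelMass-sum m)) (upTo (suc M))) ⟩
      sum (map levelMass (upTo (suc M)))
        ∎
      where open ≡-Reasoning

    mass-outside : ∀ M → mass R T (_∉ initialSegment M) ≤ mass R T (λ x → M ℕ.< sz x)
    mass-outside M = mass-mono λ x x∉F → ℕ.≰⇒> λ sz≤M →
      x∉F (Equivalence.from ∈-initialSegment (∈-upTo⁺ (ℕ.s≤s sz≤M)))

-- Tabulating a function on the machine

module Table (R : Reals) where
  open Reals R
  open RealProperties R
  open FiniteSums R
  open Runs R

  -- One round of the loop that tabulates f.  It takes the state (m, (r, ds)) to
  -- (m - 1, (r - f(m), (f(m), m) ∷ ds)), and continues as long as 0 ≤ m - 1.
  next : Prog R → Prog R
  next f = pairP idP (fstP ⨟ f) ⨟ step ⨟ test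
    where
    mP rP dsP pP step test : Prog R
    -- These read from ((m, (r, ds)), f(m)).
    mP   = fstP ⨟ fstP
    rP   = fstP ⨟ sndP ⨟ fstP
    dsP  = fstP ⨟ sndP ⨟ sndP
    pP   = sndP
    step = pairP (pairP mP (real 1#) ⨟ subP)
                 (pairP (pairP rP pP ⨟ subP) (pairP (pairP pP mP) dsP))
    test = pairP (pairP (real 0#) fstP ⨟ leqP) idP

  -- On input n: the listing that gives to each m ≤ n the weight f(m), preceded
  -- by nil with the weight 1 - f(0) - … - f(n) that is left over.
  table : Prog R → Prog R
  table f = pairP (real 1#) (pairP idP (pairP (real 1#) nilP))
            ⨟ while (next f)
            ⨟ pairP (pairP (sndP ⨟ fstP) nilP) (sndP ⨟ sndP)

  -- The loop data: a counter, the remaining weight and the listing so far.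
  state : Val R → ℝ → List (ℝ × Val R) → Val R
  state m r ds = cons m (cons (num r) (listing R ds))

  -- The line of the listing for m: its weight, and m as a machine number.
  entry : (ℕ → ℝ) → ℕ → ℝ × Val R
  entry value m = value m , num (fromℕ m)

  -- The steps of a round after f has been run and its result stored.
  nextCost : ℕ
  nextCost = 27

  -- A bound on the steps of one round if f takes at most b steps.  Four steps
  -- come before the run of f, one of them for the loop itself.
  stepBound : ℝ → ℝ
  stepBound b = fromℕ 4 + (b + fromℕ nextCost)

  -- A bound on the steps of table f on input a: there are 1 + a rounds, seven
  -- steps to set up the loop, one to leave it, and seven to put nil in front.
  tableBound : ℝ → ℝ → ℝ
  tableBound a b = fromℕ 7 + (((1# + a) * stepBound b + fromℕ 1) + fromℕ 7)

  stepBound-nonneg : ∀ {b} → 0# ≤ b → 0# ≤ stepBound b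
  stepBound-nonneg 0≤b = +-nonneg (fromℕ-nonneg 4) (+-nonneg 0≤b (fromℕ-nonneg nextCost))

  tableBound-monoˡ : ∀ {a a′ b} → 0# ≤ b → a ≤ a′ → tableBound a b ≤ tableBound a′ b
  tableBound-monoˡ 0≤b a≤a′ = +-monoʳ-≤ _ (+-monoˡ-≤ _ (+-monoˡ-≤ _
    (*-monoʳ-≤ (stepBound-nonneg 0≤b) (+-monoʳ-≤ 1# a≤a′))))

  -- A deterministic program f that computes value m from m in time m steps.
  module Tabulate (f : Prog R) (value : ℕ → ℝ) (time : ℕ → ℕ)
                  (f⇓ : ∀ m → f ▷ num (fromℕ m) ↦ num (value m) ⟨ time m ⟩) where

    next⇓ : ∀ m r ds → next f ▷ state (num (fromℕ m)) r ds
              ↦ cons (bool R (0# ≤? (fromℕ m - 1#)))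
                     (state (num (fromℕ m - 1#)) (r - value m) (entry value m ∷ ds))
              ⟨ 3 ℕ.+ (time m ℕ.+ nextCost) ⟩
    next⇓ m r ds = seq (pair ⇓id (seq ⇓fst (f⇓ m))) (seq
      (pair (seq (pair mP⇓ ⇓real) ⇓sub)
            (pair (seq (pair (seq ⇓fst (seq ⇓snd ⇓fst)) ⇓snd) ⇓sub)
                  (pair (pair ⇓snd mP⇓) (seq ⇓fst (seq ⇓snd ⇓snd)))))
      (pair (seq (pair ⇓real ⇓fst) ⇓leq) ⇓id))
      where
      mP⇓ : (fstP ⨟ fstP) ▷ cons (state (num (fromℕ m)) r ds) (num (value m))
              ↦ num (fromℕ m) ⟨ 2 ⟩
      mP⇓ = seq ⇓fst ⇓fst

    -- value 0 + … + value n
    valueSum : ℕ → ℝ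
    valueSum n = sum (map value (upTo (suc n)))

    -- The lines of the listing for 0, …, n.
    entries : ℕ → List (ℝ × Val R)
    entries n = map (entry value) (upTo (suc n))

    entries-snoc : ∀ n → entries (suc n) ≡ entries n ++ [ entry value (suc n) ]
    entries-snoc n = trans (cong (map (entry value)) (sym (upTo-∷ʳ (suc n))))
                           (map-++ (entry value) (upTo (suc n)) _)

    valueSum-suc : ∀ n → valueSum (suc n) ≡ valueSum n + value (suc n)
    valueSum-suc n = trans (cong (sum ∘ map value) (sym (upTo-∷ʳ (suc n))))
      (trans (sum-map-++ value (upTo (suc n)) _) (cong (valueSum n +_) (+-identityʳ _)))

    -- By induction on the counter.  Every round puts its entry in front of the
    -- listing, so counting down yields the entries in increasing order.  The
    -- loop stops after the round for 0, when the counter has become 0 - 1.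
    loop⇓ : ∀ n {c r ds b} → c ≢ nil → (∀ m → m ℕ.≤ n → fromℕ (time m) ≤ b) →
      ∃[ t ] while (next f) ▷ cons c (state (num (fromℕ n)) r ds)
               ↦ state (num (0# - 1#)) (r - valueSum n) (entries n ++ ds) ⟨ t ⟩
           × fromℕ t ≤ fromℕ (suc n) * stepBound b + fromℕ 1
    loop⇓ zero {r = r} {ds} {b} c≢nil time≤b
      with 0# ≤? (0# - 1#) | next⇓ 0 r ds
    ... | yes 0≤-1 | _    = contradiction 0≤-1 0≰-1
    ... | no  _    | run  = _ ,
      returning (cong (λ z → state (num (0# - 1#)) (r - z) (entry value 0 ∷ ds))
                      (sym (+-identityʳ (value 0))))
                (while-step c≢nil run ⇓stop) ,
      ≤-trans (fromℕ-+-≤ (4 ℕ.+ (time 0 ℕ.+ nextCost)) 1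
                (fromℕ-+-≤ 4 (time 0 ℕ.+ nextCost) ≤-refl
                  (fromℕ-+-≤ (time 0) nextCost (time≤b 0 ℕ.z≤n) ≤-refl)) ≤-refl)
              (≤-reflexive (cong (_+ fromℕ 1)
                (sym (trans (cong (_* stepBound b) (+-identityʳ 1#)) (*-identityˡ _)))))
    loop⇓ (suc n) {r = r} {ds} {b} c≢nil time≤b
      with loop⇓ n {r = r - value (suc n)} {ds = entry value (suc n) ∷ ds} {b = b}
             (λ ()) (λ m m≤n → time≤b m (ℕ.m≤n⇒m≤1+n m≤n))
    ... | t , rest , t≤ = _ ,
      returning (cong₂ (state (num (0# - 1#)))
                  (trans ([x-y]-z≡x-[z+y] r (value (suc n)) (valueSum n))
                         (cong (λ z → r - z) (sym (valueSum-suc n))))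
                  (trans (sym (++-assoc (entries n) [ entry value (suc n) ] ds))
                         (cong (_++ ds) (sym (entries-snoc n)))))
                (while-step c≢nil run rest) ,
      ≤-trans (fromℕ-+-≤ (4 ℕ.+ (time (suc n) ℕ.+ nextCost)) t
                (fromℕ-+-≤ 4 (time (suc n) ℕ.+ nextCost) ≤-refl
                  (fromℕ-+-≤ (time (suc n)) nextCost (time≤b (suc n) ℕ.≤-refl) ≤-refl)) t≤)
              (≤-reflexive (trans (sym (+-assoc (stepBound b) _ (fromℕ 1)))
                (cong (_+ fromℕ 1) (trans
                  (cong (_+ fromℕ (suc n) * stepBound b) (sym (*-identityˡ (stepBound b))))
                  (sym (distribʳ (stepBound b) 1# (fromℕ (suc n))))))))
      where
      -- The counter is now n ≥ 0, so the loop goes on.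
      continue : bool R (0# ≤? (fromℕ (suc n) - 1#)) ≡ num 1#
      continue with 0# ≤? (fromℕ (suc n) - 1#)
      ... | yes _ = refl
      ... | no  p = contradiction (subst (0# ≤_) (sym (fromℕ-pred n)) (fromℕ-nonneg n)) p
      run : next f ▷ state (num (fromℕ (suc n))) r ds
              ↦ cons (num 1#) (state (num (fromℕ n)) (r - value (suc n)) (entry value (suc n) ∷ ds))
              ⟨ 3 ℕ.+ (time (suc n) ℕ.+ nextCost) ⟩
      run = returning (cong₂ (λ flag x → cons flag
                                (state (num x) (r - value (suc n)) (entry value (suc n) ∷ ds)))
                             continue (fromℕ-pred n))
                      (next⇓ (suc n) r ds)

    table⇓ : ∀ n {b} → (∀ m → m ℕ.≤ n → fromℕ (time m) ≤ b) →
      ∃[ t ] table f ▷ num (fromℕ n)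
               ↦ listing R ((1# - valueSum n , nil) ∷ entries n) ⟨ t ⟩
           × fromℕ t ≤ tableBound (fromℕ n) b
    table⇓ n {b} time≤b with loop⇓ n {c = num 1#} {r = 1#} {ds = []} (λ ()) time≤b
    ... | t , run , t≤ = _ ,
      returning (cong (λ es → listing R ((1# - valueSum n , nil) ∷ es))
                      (++-identityʳ (entries n)))
                (seq (pair ⇓real (pair ⇓id (pair ⇓real ⇓nil)))
                  (seq run (pair (pair (seq ⇓snd ⇓fst) ⇓nil) (seq ⇓snd ⇓snd)))) ,
      fromℕ-+-≤ 7 (t ℕ.+ 7) ≤-refl (fromℕ-+-≤ t 7 t≤ ≤-refl)

-- Sampling by size

module Sampling (R : Reals) {A : Set} (T : Distribution R A) (code : Dom R T ↣ Val R)
                (sz : Dom R T → ℕ) (finite : IsSizeFunction R T code sz)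
                (sizeSelect : Prog R) (c : Reals.ℝ R) (k : ℕ)
                (selects : ∀ m → (∃[ x ] sz x ≡ m) →
                   ∃[ μ ] _⊢_⇓_ R sizeSelect (num (Reals.fromℕ R m)) μ
                        × (∀ x → Pr R (λ v → _≟V_ R v (Injection.to code x)) μ
                                 ≡ conditional R T (λ z → sz z ℕ.≟ m) x)
                        × TimeAtMost R (poly R c k (Reals.fromℕ R m)) μ) where
  open Reals R
  open RealProperties R
  open FiniteSums R
  open Runs R
  open Table R
  open Masses R T
  open Levels sz finite
  open Injection code using (to)

  -- What follows the choice from the table.  If a size was chosen, an element of
  -- that size is selected; nil stands for ⊥.  The outer pairing with nil leaves
  -- the static variable empty.
  branch : Prog R
  branch = pairP idP idP ⨟ cond (pairP (pairP sizeSelect nilP) nilP) (pairP nilP nilP)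

  branch-⊥ : branch ▷ nil ↦ cons nil nil ⟨ 7 ⟩
  branch-⊥ = seq (pair ⇓id ⇓id) (⇓false (pair ⇓nil ⇓nil))

  -- The effect of branch on an outcome of sizeSelect: three steps to duplicate
  -- the size, one for cond, and two for each pairing with nil.
  emit : Outcome R → Outcome R
  emit (outcome w c v) = outcome w (8 ℕ.+ c) (cons (cons v nil) nil)

  branch-num : ∀ {a μ} → sizeSelect ▷ num a ⇓ μ → branch ▷ num a ⇓ map emit μ
  branch-num {a} {μ} run = subst (branch ▷ num a ⇓_) emitted
    (seq (pair ⇓id ⇓id) (⇓true (λ ()) (pair-nil (pair-nil run))))
    where
    emitted : map (delay 3) (map (tick R) (map attachNil (map attachNil μ))) ≡ map emit μ
    emitted = trans (cong (map (delay 3) ∘ map (tick R)) (sym (map-∘ μ)))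
                    (trans (cong (map (delay 3)) (sym (map-∘ μ))) (sym (map-∘ μ)))

  -- T(sz⁻¹(m)) · (T | sz⁻¹(m))(x) is T(x) if x has size m and 0 otherwise; the
  -- division is legitimate because a level with an element has positive mass.
  level-share : ∀ m x → levelMass m * conditional R T (λ z → sz z ℕ.≟ m) x
                        ≡ indicator (prob R T x) (sz x) m
  level-share m x with sz x ℕ.≟ m
  ... | yes refl = *-cancel-/ (prob R T x) (inhabited⇒levelMass≢0 x)
  ... | no  _    = zeroʳ (levelMass m)

  -- Choosing v with probability d from a listing of length ℓ.
  option : ℕ → ℝ × Val R → Outcome R
  option ℓ (d , v) = outcome d ℓ v

  module _ (M ℓ : ℕ) where

    -- A bound on the steps of choosing ⊥ or a size m ≤ M, from a listing of
    -- length ℓ, and then running branch.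
    sampleBound : ℝ
    sampleBound = fromℕ ℓ + (fromℕ 8 + poly R (positivePart c) k (fromℕ M))

    -- The outcomes of choosing a size from ms by its mass and then running
    -- branch.  A size of mass 0 is never chosen; a size of positive mass has an
    -- element, so that sizeSelect may be called.
    branches⇓ : ∀ ms → All (ℕ._≤ M) ms →
      ∃[ ν ] _⊢*_⇓_ R branch (possible R (map (option ℓ) (map (entry levelMass) ms))) ν
           × (∀ x → Pr R (output? R T code (just x)) ν
                    ≡ sum (map (indicator (prob R T x) (sz x)) ms))
           × Pr R (output? R T code nothing) ν ≡ 0#
           × TimeAtMost R sampleBound ν
    branches⇓ []       _            = [] , [] , (λ _ → refl) , refl , []
    branches⇓ (m ∷ ms) (m≤M ∷ ms≤M) with levelMass m ≟ 0# | branches⇓ ms ms≤M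
    ... | yes p≡0 | ν , runs , Pr-just , Pr-⊥ , fast =
      ν , runs ,
      (λ x → trans (Pr-just x) (trans (sym (+-identityˡ _))
        (cong (_+ sum (map (indicator (prob R T x) (sz x)) ms)) (sym (share≡0 x))))) ,
      Pr-⊥ , fast
      where
      share≡0 : ∀ x → indicator (prob R T x) (sz x) m ≡ 0#
      share≡0 x = trans (sym (level-share m x))
        (trans (cong (_* conditional R T (λ z → sz z ℕ.≟ m) x) p≡0)
               (zeroˡ (conditional R T (λ z → sz z ℕ.≟ m) x)))
    ... | no p≢0 | ν , runs , Pr-just , Pr-⊥ , fast
      with (μ , run , conditional≡ , μ-fast) ←
             selects m (levelMass≢0⇒inhabited m p≢0) =
      map (after R o) (map emit μ) ++ ν ,
      branch-num run ∷ runs ,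
      (λ x → trans (Pr-++ (output? R T code (just x)) (map (after R o) (map emit μ)) ν)
                   (cong₂ _+_ (level-Pr x) (Pr-just x))) ,
      trans (Pr-++ (output? R T code nothing) (map (after R o) (map emit μ)) ν)
            (trans (cong₂ _+_ (Pr-none (output? R T code nothing) never-⊥) Pr-⊥)
                   (+-identityʳ 0#)) ,
      All.++⁺ (All.map⁺ (All.map⁺ (All.map (λ {o′} → bound {o′}) μ-fast))) fast
      where
      o : Outcome R
      o = option ℓ (entry levelMass m)
      level-Pr : ∀ x → Pr R (output? R T code (just x)) (map (after R o) (map emit μ))
                       ≡ indicator (prob R T x) (sz x) m
      level-Pr x = begin
        Pr R (output? R T code (just x)) (map (after R o) (map emit μ))
          ≡⟨ cong (Pr R (output? R T code (just x))) (map-∘ μ) ⟨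
        Pr R (output? R T code (just x)) (map (after R o ∘ emit) μ)
          ≡⟨ Pr-map (output? R T code (just x)) (λ v → _≟V_ R v (to x))
               {f = after R o ∘ emit} (λ _ → refl)
               (λ _ → mk⇔ (λ { (_ , refl) → refl }) (λ { refl → nil , refl })) μ ⟩
        levelMass m * Pr R (λ v → _≟V_ R v (to x)) μ
          ≡⟨ cong (levelMass m *_) (conditional≡ x) ⟩
        levelMass m * conditional R T (λ z → sz z ℕ.≟ m) x
          ≡⟨ level-share m x ⟩
        indicator (prob R T x) (sz x) m
          ∎
        where open ≡-Reasoning
      never-⊥ : All (¬_ ∘ Output R T code nothing ∘ result) (map (after R o) (map emit μ))
      never-⊥ = All.map⁺ (All.map⁺ (All.universal (λ { _ (_ , ()) }) μ))
      bound : ∀ {o′ : Outcome R} → fromℕ (cost o′) ≤ poly R c k (fromℕ m) →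
              fromℕ (ℓ ℕ.+ (8 ℕ.+ cost o′)) ≤ sampleBound
      bound {o′} c≤ = fromℕ-+-≤ ℓ (8 ℕ.+ cost o′) ≤-refl (fromℕ-+-≤ 8 (cost o′) ≤-refl
        (≤-trans c≤ (poly-mono k (fromℕ-nonneg m) (fromℕ-mono-≤ m≤M))))

    -- The same with ⊥, of weight r, as a further choice.
    ⊥branches⇓ : ∀ r ms → All (ℕ._≤ M) ms →
      ∃[ ν ] _⊢*_⇓_ R branch (possible R (map (option ℓ) ((r , nil) ∷ map (entry levelMass) ms))) ν
           × (∀ x → Pr R (output? R T code (just x)) ν
                    ≡ sum (map (indicator (prob R T x) (sz x)) ms))
           × Pr R (output? R T code nothing) ν ≡ r
           × TimeAtMost R sampleBound ν
    ⊥branches⇓ r ms ms≤M with r ≟ 0# | branches⇓ ms ms≤M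
    ... | yes refl | ν , runs , Pr-just , Pr-⊥ , fast = ν , runs , Pr-just , Pr-⊥ , fast
    ... | no  _    | ν , runs , Pr-just , Pr-⊥ , fast =
      outcome (r * 1#) (ℓ ℕ.+ 7) (cons nil nil) ∷ ν ,
      branch-⊥ ∷ runs , Pr-just ,
      trans (cong₂ _+_ (*-identityʳ r) Pr-⊥) (+-identityʳ r) ,
      fromℕ-+-≤ ℓ 7 ≤-refl (≤-trans (fromℕ-mono-≤ {7} {8} (ℕ.n≤1+n 7))
        (x≤x+y (poly-nonneg k (0≤positivePart c) (fromℕ-nonneg M)))) ∷ fast

-- The selection algorithm

theorem3p5 : (R : Reals) {A : Set} (T : Distribution R A) (code : Dom R T ↣ Val R) →
    LocallyTractable R T code → Tractable R T code
theorem3p5 R T code (sz , finite , (sizeSelect , c₁ , k₁ , selects)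
                                 , (probT , c₂ , k₂ , computes)
                                 , (maxLen , c₃ , k₃ , C , j , bounds)) =
  tractable time-growth
  where
  open Reals R
  open RealProperties R
  open FiniteSums R
  open Runs R
  open Table R
  open Masses R T
  open Levels sz finite
  open Sampling R T code sz finite sizeSelect c₁ k₁ selects
  open Tabulate probT levelMass (proj₁ ∘ computes) (proj₁ ∘ proj₂ ∘ computes)

  -- The contents of the static variable are ignored, since F depends on δ only.
  select : Prog R
  select = fstP ⨟ maxLen ⨟ table probT ⨟ choose ⨟ branch

  -- A bound on M, for x = 1/δ.
  sizeBound : ℝ → ℝ
  sizeBound x = positivePart C * x ^ j

  -- A bound on the steps of select, for x = 1/δ.  The summands belong to the
  -- extraction of δ, maxLen, table, choose (from a listing of length M + 2) and
  -- branch.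
  timeBound : ℝ → ℝ
  timeBound x =
    fromℕ 1 + (poly R (positivePart c₃) k₃ x
      + (tableBound (sizeBound x) (poly R (positivePart c₂) k₂ (sizeBound x))
        + ((fromℕ 2 + sizeBound x)
          + (fromℕ 8 + poly R (positivePart c₁) k₁ (sizeBound x)))))

  time-growth : PolyGrowth timeBound
  time-growth =
    +-growth (fromℕ-growth 1) (+-growth (poly-growth k₃ (0≤positivePart c₃) id-growth)
      (+-growth (+-growth (fromℕ-growth 7) (+-growth (+-growth
                  (*-growth (+-growth (const-growth 0≤1) size-growth)
                            (+-growth (fromℕ-growth 4) (+-growth
                              (poly-growth k₂ (0≤positivePart c₂) size-growth)
                              (fromℕ-growth nextCost))))
                  (fromℕ-growth 1)) (fromℕ-growth 7)))
        (+-growth (+-growth (fromℕ-growth 2) size-growth)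
          (+-growth (fromℕ-growth 8) (poly-growth k₁ (0≤positivePart c₁) size-growth)))))
    where
    fromℕ-growth : ∀ n → PolyGrowth (λ _ → fromℕ n)
    fromℕ-growth n = const-growth (fromℕ-nonneg n)
    size-growth : PolyGrowth sizeBound
    size-growth = *-growth (const-growth (0≤positivePart C)) (^-growth id-growth j)

  -- The specification of tractability with F = {x : sz x ≤ M}, with the explicit
  -- time bound, and for every content s of the static variable.
  correct : ∀ δ → 0# < δ → δ < 1# →
    ∃[ F ] mass R T (_∉ F) ≤ δ ×
      (∀ s → ∃[ μ ] select ▷ cons (num δ) s ⇓ μ
                  × (∀ y → Pr R (output? R T code y) μ ≡ truncate R T F y)
                  × TimeAtMost R (timeBound (δ ⁻¹)) μ)
  correct δ 0<δ δ<1
    with M , tail≤δ , M≤ , tₘ , maxLen⇓ , tₘ≤ ← bounds δ 0<δ δ<1 =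
    initialSegment M , ≤-trans (mass-outside M) tail≤δ , run
    where
    x : ℝ
    x = δ ⁻¹
    1≤x : 1# ≤ x
    1≤x = 1≤x⁻¹ 0<δ δ<1
    M≤size : fromℕ M ≤ sizeBound x
    M≤size = ≤-trans M≤ (*-monoʳ-≤ (^-nonneg j (1≤⇒0≤ 1≤x)) (≤positivePart C))
    -- A bound on the steps of probT on every size up to M.
    b : ℝ
    b = poly R (positivePart c₂) k₂ (sizeBound x)
    0≤b : 0# ≤ b
    0≤b = poly-nonneg k₂ (0≤positivePart c₂) (≤-trans (fromℕ-nonneg M) M≤size)

    -- The weight of ⊥, and the listing that select chooses from.
    r : ℝ
    r = 1# - valueSum M
    ds : List (ℝ × Val R)
    ds = (r , nil) ∷ entries M

    0≤r : 0# ≤ r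
    0≤r = x≤y⇒0≤y-x (subst (_≤ 1#) (mass-initialSegment M) (mass≤1 (_∈ initialSegment M)))
    weights : sum (map proj₁ ds) ≡ 1#
    weights = trans (cong (λ ps → r + sum ps) (sym (map-∘ (upTo (suc M)))))
                    (x-y+y≡x 1# (valueSum M))
    choose⇓ : choose ▷ listing R ds ⇓ possible R (map (option (length ds)) ds)
    choose⇓ = ⇓choose ds (0≤r ∷ All.map⁺ (All.universal levelMass-nonneg _)) weights

    sampleBound≤ : sampleBound M (length ds)
                   ≤ (fromℕ 2 + sizeBound x)
                     + (fromℕ 8 + poly R (positivePart c₁) k₁ (sizeBound x))
    sampleBound≤ = +-mono-≤
      (subst (λ ℓ → fromℕ ℓ ≤ fromℕ 2 + sizeBound x) (sym length-ds)
             (fromℕ-+-≤ 2 M ≤-refl M≤size))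
      (+-monoʳ-≤ (fromℕ 8) (+-monoˡ-≤ _
        (*-monoˡ-≤ (0≤positivePart c₁) (^-monoˡ-≤ k₁ (fromℕ-nonneg M) M≤size))))
      where
      length-ds : length ds ≡ 2 ℕ.+ M
      length-ds = cong suc (trans (length-map (entry levelMass) (upTo (suc M)))
                                  (length-upTo (suc M)))

    Pr-truncate : ∀ ν →
      (∀ z → Pr R (output? R T code (just z)) ν
             ≡ sum (map (indicator (prob R T z) (sz z)) (upTo (suc M)))) →
      Pr R (output? R T code nothing) ν ≡ r →
      ∀ y → Pr R (output? R T code y) ν ≡ truncate R T (initialSegment M) y
    Pr-truncate ν Pr-just Pr-⊥ nothing =
      trans Pr-⊥ (cong (λ z → 1# - z) (sym (mass-initialSegment M)))
    Pr-truncate ν Pr-just Pr-⊥ (just z)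
      with DecMembership._∈?_ ℕ._≟_ (sz z) (upTo (suc M))
    ... | yes z∈ = trans (Pr-just z) (trans (sum-indicator-∈ _ _ (Unique.upTo⁺ (suc M)) z∈)
                     (sym (truncate-∈ (Equivalence.from ∈-initialSegment z∈))))
    ... | no  z∉ = trans (Pr-just z) (trans (sum-indicator-∉ _ _ _ z∉)
                     (sym (truncate-∉ (z∉ ∘ Equivalence.to ∈-initialSegment))))

    run : ∀ s →
      ∃[ μ ] select ▷ cons (num δ) s ⇓ μ
           × (∀ y → Pr R (output? R T code y) μ ≡ truncate R T (initialSegment M) y)
           × TimeAtMost R (timeBound x) μ
    run s =
      let tₜ , table-run , tₜ≤ = table⇓ M {b} λ m m≤M →
            ≤-trans (proj₂ (proj₂ (computes m)))
                    (poly-mono k₂ (fromℕ-nonneg m) (≤-trans (fromℕ-mono-≤ m≤M) M≤size))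
          ν , branch-runs , Pr-just , Pr-⊥ , fast =
            ⊥branches⇓ M (length ds) r (upTo (suc M)) (All.tabulate (ℕ.s≤s⁻¹ ∘ ∈-upTo⁻))
      in
      map (delay 1) (map (delay tₘ) (map (delay tₜ) ν)) ,
      seq ⇓fst (seq maxLen⇓ (seq table-run (⇓seq choose⇓ branch-runs))) ,
      (λ y → let event = output? R T code y in begin
        Pr R event (map (delay 1) (map (delay tₘ) (map (delay tₜ) ν)))
          ≡⟨ Pr-delay event 1 (map (delay tₘ) (map (delay tₜ) ν)) ⟩
        Pr R event (map (delay tₘ) (map (delay tₜ) ν))
          ≡⟨ Pr-delay event tₘ (map (delay tₜ) ν) ⟩
        Pr R event (map (delay tₜ) ν)
          ≡⟨ Pr-delay event tₜ ν ⟩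
        Pr R event ν
          ≡⟨ Pr-truncate ν Pr-just Pr-⊥ y ⟩
        truncate R T (initialSegment M) y
          ∎) ,
      All.map⁺ (All.map⁺ (All.map⁺ (All.map (λ {o} → within tₜ tₜ≤ {o}) fast)))
      where
      open ≡-Reasoning
      within : ∀ tₜ → fromℕ tₜ ≤ tableBound (fromℕ M) b →
               ∀ {o : Outcome R} → fromℕ (cost o) ≤ sampleBound M (length ds) →
               fromℕ (1 ℕ.+ (tₘ ℕ.+ (tₜ ℕ.+ cost o))) ≤ timeBound x
      within tₜ tₜ≤ {o} c≤ = fromℕ-+-≤ 1 (tₘ ℕ.+ (tₜ ℕ.+ cost o)) ≤-refl
        (fromℕ-+-≤ tₘ (tₜ ℕ.+ cost o) (≤-trans tₘ≤ (poly-mono k₃ (1≤⇒0≤ 1≤x) ≤-refl))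
          (fromℕ-+-≤ tₜ (cost o) (≤-trans tₜ≤ (tableBound-monoˡ 0≤b M≤size))
            (≤-trans c≤ sampleBound≤)))

  tractable : PolyGrowth timeBound → Tractable R T code
  tractable (c , k , 0≤c , time≤) = select , c , k , λ δ 0<δ δ<1 →
    let F , tail≤δ , run = correct δ 0<δ δ<1 in
    F , tail≤δ , λ s _ →
      let μ , μ⇓ , Pr≡ , fast = run s in
      μ , μ⇓ , Pr≡ ,
      All.map (λ t≤ → ≤-trans t≤
                 (≤-trans (proj₂ (time≤ (δ ⁻¹) (1≤x⁻¹ 0<δ δ<1))) (x≤x+y 0≤c))) fast
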